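{- Let $\Delta$ be a simplicial complex on vertex set $[n]$, and let $\Delta^\vee$ be its Alexander dual. (i) If $\Delta$ is skeleton-E-chordal, then $\Delta^\vee$ is vertex-decomposable. (ii) If $\Delta^\vee$ is vertex-decomposable, then $\Delta$ is skeleton-clique-chordal. In particular, for any subflag simplicial complex $\Delta$, $$\Delta \text{ is skeleton-E-chordal} \iff \Delta^\vee \text{ is vertex-decomposable}.$$
   Context: Simplicial complexes are finite and not necessarily pure. A vertex labeling of a complex with $n$ vertices is a bijection of its vertices with $[n]=\{1,\dots,n\}$; $\max f$ is the largest label in a face $f$; the size of a face is its number of vertices. $\Delta$ is skeleton-E-chordal if it has a vertex labeling such that for every two faces $f\neq g$ of $\Delta$ with the same size and the same maximum, every subset $h\subseteq f\cup g$ with $|h|=|f|$ is a face of $\Delta$. $\Delta$ is skeleton-clique-chordal if it has a vertex labeling such that for every two faces $f\ne g$ of $\Delta$ with the same size $\ge 2$ and the same maximum, every $2$-element subset of $f\cup g$ is a face of $\Delta$. A clique of $\Delta$ is a set of vertices any two of which span an edge of $\Delta$. $\Delta$ is subflag if every clique of size $\le \dim\Delta+1$ is a face of $\Delta$. The Alexander dual of $\Delta$ on vertex set $[n]$ is $\Delta^\vee=\{F\subseteq[n] : [n]\setminus F\notin\Delta\}$. A vertex $v$ of a complex $\Gamma$ is shedding if no facet of $\operatorname{link}(v,\Gamma)$ is also a facet of $\operatorname{del}(v,\Gamma)$, where $\operatorname{del}(v,\Gamma)$ is the subcomplex of all faces not containing $v$. A (not necessarily pure) complex $\Gamma$ is vertex-decomposable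 if it is a simplex, or $\Gamma=\{\emptyset\}$, or $\Gamma=\emptyset$, or (recursively) it has a shedding vertex $v$ such that $\operatorname{del}(v,\Gamma)$ and $\operatorname{link}(v,\Gamma)$ are both vertex-decomposable. -}

module Defs where

open import Data.Fin.Base as Fin using (Fin)
open import Data.Fin.Subset
  using (Subset; _∈_; _∉_; _⊆_; _∪_; ∁; ⊥; ⁅_⁆; ∣_∣)
open import Data.Fin.Subset.Properties
  using (_∈?_; p⊆q⇒∁p⊇∁q; x∈p∪q⁻; x∈p∪q⁺)
open import Data.Integer.Base as ℤ using (ℤ; +_; 1ℤ)
open import Data.Nat.Base as ℕ using (ℕ)
open import Data.Product.Base using (_×_; _,_; ∃; ∃-syntax)
open import Data.Refinement.Base using (Refinement-syntax; value)
open import Data.Sum.Base using (map₁)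
open import Function.Base using (_∘_)
open import Function.Bundles using (_⇔_; _↔_; Inverse)
open import Relation.Binary.PropositionalEquality.Core using (_≡_; _≢_)
open import Relation.Nullary.Decidable.Core using (¬?; _×-dec_)
open import Relation.Nullary.Negation.Core using (¬_)
open import Relation.Unary using (Pred; Decidable)
open import Level using (0ℓ)

-- A complex with vertices among Fin n.  Neither ∅ nor the singletons are
-- required to be faces: Alexander duals, links and deletions are kept on the
-- same ground set, so a point of Fin n need not be a vertex, and the complex
-- without faces is allowed.  Faces form a genuine finite family of sets, hence
-- the decidability.
record Complex (n : ℕ) : Set₁ where
  field
    Face   : Pred (Subset n) 0ℓ
    face?  : Decidable Face
    closed : ∀ {F G} → G ⊆ F → Face F → Face G

open Complex public

module _ {n : ℕ} where

  infix 8 _^∨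

  _^∨ : Complex n → Complex n
  (Δ ^∨) .Face F           = ¬ Face Δ (∁ F)
  (Δ ^∨) .face? F          = ¬? (face? Δ (∁ F))
  (Δ ^∨) .closed G⊆F ∁F∉Δ  = ∁F∉Δ ∘ closed Δ (p⊆q⇒∁p⊇∁q G⊆F)

  del : Fin n → Complex n → Complex n
  del v Γ .Face F                   = v ∉ F × Face Γ F
  del v Γ .face? F                  = ¬? (v ∈? F) ×-dec face? Γ F
  del v Γ .closed G⊆F (v∉F , F∈Γ)   = v∉F ∘ G⊆F , closed Γ G⊆F F∈Γ

  link : Fin n → Complex n → Complex n
  link v Γ .Face F                       = v ∉ F × Face Γ (F ∪ ⁅ v ⁆)
  link v Γ .face? F                      = ¬? (v ∈? F) ×-dec face? Γ (F ∪ ⁅ v ⁆)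
  link v Γ .closed {F} {G} G⊆F (v∉F , F∈Γ) =
    v∉F ∘ G⊆F , closed Γ (x∈p∪q⁺ ∘ map₁ G⊆F ∘ x∈p∪q⁻ G ⁅ v ⁆) F∈Γ

  IsVertex : Complex n → Fin n → Set
  IsVertex Γ v = Face Γ ⁅ v ⁆

  IsFacet : Complex n → Subset n → Set
  IsFacet Γ F = Face Γ F × (∀ G → Face Γ G → F ⊆ G → G ≡ F)

  IsShedding : Complex n → Fin n → Set
  IsShedding Γ v =
    IsVertex Γ v × (∀ F → IsFacet (link v Γ) F → ¬ IsFacet (del v Γ) F)

  IsSimplex : Complex n → Set
  IsSimplex Γ = ∃[ W ] ∀ F → Face Γ F ⇔ F ⊆ W

  data VertexDecomposable (Γ : Complex n) : Set where
    simplex  : IsSimplex Γ → VertexDecomposable Γ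
    only-∅   : (∀ F → Face Γ F ⇔ F ≡ ⊥) → VertexDecomposable Γ
    no-faces : (∀ F → ¬ Face Γ F) → VertexDecomposable Γ
    shed     : ∀ v → IsShedding Γ v →
               VertexDecomposable (del v Γ) →
               VertexDecomposable (link v Γ) →
               VertexDecomposable Γ

  -- The refinement type makes the proof of being a vertex irrelevant.
  Vertex : Complex n → Set
  Vertex Δ = [ v ∈ Fin n ∣ IsVertex Δ v ]

  -- Labels 1 < ... < k are represented by Fin k with its usual order; the
  -- bijection forces k to be the number of vertices of Δ.
  VertexLabeling : Complex n → Set
  VertexLabeling Δ = ∃[ k ] Vertex Δ ↔ Fin k

  module _ {Δ : Complex n} where

    HasMax : ((k , _) : VertexLabeling Δ) → Subset n → Fin k → Set
    HasMax (k , ℓ) f m =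
      (∃[ v ] value v ∈ f × label v ≡ m) ×
      (∀ v → value v ∈ f → label v Fin.≤ m)
      where
      label : Vertex Δ → Fin k
      label = Inverse.to ℓ

    SameMax : VertexLabeling Δ → Subset n → Subset n → Set
    SameMax ℓ f g = ∃[ m ] HasMax ℓ f m × HasMax ℓ g m

  SkeletonEChordal : Complex n → Set
  SkeletonEChordal Δ = ∃ λ (ℓ : VertexLabeling Δ) →
    ∀ f g → Face Δ f → Face Δ g → f ≢ g → ∣ f ∣ ≡ ∣ g ∣ → SameMax {Δ} ℓ f g →
    ∀ h → h ⊆ f ∪ g → ∣ h ∣ ≡ ∣ f ∣ → Face Δ h

  SkeletonCliqueChordal : Complex n → Set
  SkeletonCliqueChordal Δ = ∃ λ (ℓ : VertexLabeling Δ) →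
    ∀ f g → Face Δ f → Face Δ g → f ≢ g → ∣ f ∣ ≡ ∣ g ∣ → 2 ℕ.≤ ∣ f ∣ →
    SameMax {Δ} ℓ f g →
    ∀ e → e ⊆ f ∪ g → ∣ e ∣ ≡ 2 → Face Δ e

  IsClique : Complex n → Subset n → Set
  IsClique Δ K =
    (∀ v → v ∈ K → IsVertex Δ v) ×
    (∀ u v → u ∈ K → v ∈ K → u ≢ v → Face Δ (⁅ u ⁆ ∪ ⁅ v ⁆))

  -- dim Δ = d.  The complex {∅} has dimension -1; the complex without faces
  -- has no dimension (it is -∞), so it is vacuously subflag below.
  HasDim : Complex n → ℤ → Set
  HasDim Δ d =
    (∃[ F ] Face Δ F × + ∣ F ∣ ≡ d ℤ.+ 1ℤ) ×
    (∀ F → Face Δ F → + ∣ F ∣ ℤ.≤ d ℤ.+ 1ℤ)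

  Subflag : Complex n → Set
  Subflag Δ = ∀ d → HasDim Δ d →
    ∀ K → IsClique Δ K → + ∣ K ∣ ℤ.≤ d ℤ.+ 1ℤ → Face Δ K

{-# OPTIONS --safe #-}
-- Alexander duality exchanges deletion and link, so shedding can be read off Δ:
-- a vertex v of the dual is shedding exactly when every N avoiding v, all of
-- whose sets (N - z) ∪ v are faces of Δ, is itself a face of Δ.  Ground-set
-- points that are not vertices of Δ have this property trivially; once they are
-- shed, so does the vertex with the largest label if Δ is skeleton-E-chordal, and
-- its link is then skeleton-E-chordal for every order.  Conversely, labelling the
-- vertices shed first by the largest labels gives a skeleton-clique-chordal
-- labeling: the case |N| = 2 of the exchange property provides the missing edges.
module Submission where

open import Defs
open import Data.Fin.Base as Fin using (Fin; zero; suc; toℕ)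
import Data.Fin.Properties as Fin
open import Data.Fin.Subset
  using (Subset; inside; outside; _∈_; _∉_; _⊆_; _⊂_; _∪_; _─_; _-_; ⊤; ⊥;
         ⁅_⁆; ∣_∣; Nonempty)
open import Data.Fin.Subset.Induction using (Acc; acc; ⊂-wellFounded)
open import Data.Fin.Subset.Properties
open import Data.Integer.Base as ℤ using (+_; 1ℤ)
open import Data.Irrelevant using ([_])
open import Data.List.Base as List using (List; []; _∷_; allFin; filter; length)
open import Data.List.Extrema.Nat using (argmax; argmax-all; f[xs]≤f[argmax])
open import Data.List.Membership.Propositional using () renaming (_∈_ to _∈ₗ_)
open import Data.List.Membership.Propositional.Properties
  using (∈-lookup; ∈-filter⁺; ∈-filter⁻; ∈-allFin)
open import Data.List.Relation.Binary.Permutation.Propositional using (↭-sym; ↭⇒↭ₛ)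
open import Data.List.Relation.Binary.Permutation.Propositional.Properties
  using (∈-resp-↭)
import Data.List.Relation.Binary.Permutation.Setoid.Properties as Permutationₛ
import Data.List.Relation.Unary.All as All
open import Data.List.Relation.Unary.All.Properties using (all-filter)
open import Data.List.Relation.Unary.AllPairs using ([]; _∷_)
open import Data.List.Relation.Unary.Any using (index)
open import Data.List.Relation.Unary.Any.Properties using (lookup-index)
open import Data.List.Relation.Unary.Sorted.TotalOrder.Properties using (lookup-mono-≤)
open import Data.List.Relation.Unary.Unique.Propositional using (Unique)
import Data.List.Relation.Unary.Unique.Propositional.Properties as Unique
import Data.List.Sort as Sort
open import Data.Nat.Base as ℕ using (ℕ; zero; suc; _≤_; z≤n; s≤s⁻¹)
import Data.Nat.Properties as ℕ
open import Data.Product.Base using (_×_; _,_; ∃-syntax; proj₁; proj₂)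
open import Data.Refinement.Base using (value; _,_)
open import Data.Refinement.Properties using (value-injective)
open import Data.Sum.Base using (_⊎_; inj₁; inj₂; [_,_]′)
open import Data.Vec.Base using (_∷_; here; there)
open import Function.Base using (_∘_; case_of_; const)
open import Function.Bundles using (_⇔_; mk⇔; Equivalence; Injection; Inverse; mk↔ₛ′)
open import Function.Properties.Inverse using (↔⇒↣)
open import Relation.Binary.Bundles using (DecTotalOrder)
import Relation.Binary.Construct.Flip.EqAndOrd as Flip
import Relation.Binary.Construct.On as On
open import Relation.Binary.PropositionalEquality
  using (_≡_; _≢_; refl; sym; trans; cong; subst; subst₂; setoid)
open import Relation.Nullary using (yes; no; ¬_; contradiction; ¬?; _×-dec_)
open import Relation.Nullary.Decidable using (recompute; decidable-stable)

open Equivalence using (to; from)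

private variable
  n : ℕ
  x v : Fin n
  p q W : Subset n

-- Finite subsets

x∈p─q⇒x∉q : ∀ (p q : Subset n) → x ∈ p ─ q → x ∉ q
x∈p─q⇒x∉q (_ ∷ p) (_ ∷ q) (there x∈) (there x∈q) = x∈p─q⇒x∉q p q x∈ x∈q

x∈p-y⇒x≢y : ∀ (p : Subset n) {x y} → x ∈ p - y → x ≢ y
x∈p-y⇒x≢y p {y = y} x∈p-y refl = x∈p─q⇒x∉q p ⁅ y ⁆ x∈p-y (x∈⁅x⁆ y)

p-x⊆p : ∀ (p : Subset n) x → p - x ⊆ p
p-x⊆p p x = p─q⊆p p ⁅ x ⁆

x∈p∪⁅y⁆⁻ : ∀ (p : Subset n) {x y} → x ∈ p ∪ ⁅ y ⁆ → x ∈ p ⊎ x ≡ y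
x∈p∪⁅y⁆⁻ p {y = y} x∈ with x∈p∪q⁻ p ⁅ y ⁆ x∈
... | inj₁ x∈p = inj₁ x∈p
... | inj₂ x∈y = inj₂ (x∈⁅y⁆⇒x≡y y x∈y)

p⊆p∪⁅x⁆ : ∀ (p : Subset n) x → p ⊆ p ∪ ⁅ x ⁆
p⊆p∪⁅x⁆ p x = p⊆p∪q ⁅ x ⁆

x∈p∪⁅x⁆ : ∀ (p : Subset n) x → x ∈ p ∪ ⁅ x ⁆
x∈p∪⁅x⁆ p x = q⊆p∪q p ⁅ x ⁆ (x∈⁅x⁆ x)

∪-⁅⁆-⊆ : p ⊆ q → x ∈ q → p ∪ ⁅ x ⁆ ⊆ q
∪-⁅⁆-⊆ {p = p} p⊆q x∈q y∈ with x∈p∪⁅y⁆⁻ p y∈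
... | inj₁ y∈p = p⊆q y∈p
... | inj₂ refl = x∈q

⁅x⁆⊆p : x ∈ p → ⁅ x ⁆ ⊆ p
⁅x⁆⊆p {x = x} x∈p y∈ with refl ← x∈⁅y⁆⇒x≡y x y∈ = x∈p

p⊆p-x∪⁅x⁆ : ∀ (p : Subset n) x → p ⊆ (p - x) ∪ ⁅ x ⁆
p⊆p-x∪⁅x⁆ p x {y} y∈p with y Fin.≟ x
... | yes refl = x∈p∪⁅x⁆ (p - x) x
... | no y≢x = p⊆p∪⁅x⁆ (p - x) x (x∈p∧x≢y⇒x∈p-y y∈p y≢x)

⊆-avoiding : p ⊆ W → v ∉ p → p ⊆ W - v
⊆-avoiding p⊆W v∉p x∈p = x∈p∧x≢y⇒x∈p-y (p⊆W x∈p) λ { refl → v∉p x∈p }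

v∉W-v : ∀ (W : Subset n) v → v ∉ W - v
v∉W-v W v v∈ = x∈p-y⇒x≢y W v∈ refl

p-x─q≡p─q∪⁅x⁆ : ∀ (p q : Subset n) x → p - x ─ q ≡ p ─ (q ∪ ⁅ x ⁆)
p-x─q≡p─q∪⁅x⁆ p q x = trans (p─q─r≡p─r─q p ⁅ x ⁆ q) (p─q─r≡p─q∪r p q ⁅ x ⁆)

─-antimonoʳ : ∀ (W : Subset n) → p ⊆ q → W ─ q ⊆ W ─ p
─-antimonoʳ {q = q} W p⊆q x∈ =
  x∈p∧x∉q⇒x∈p─q (p─q⊆p W q x∈) (x∈p─q⇒x∉q W q x∈ ∘ p⊆q)

p⊆W─[W─p] : ∀ (W : Subset n) → p ⊆ W → p ⊆ W ─ (W ─ p)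
p⊆W─[W─p] {p = p} W p⊆W x∈p =
  x∈p∧x∉q⇒x∈p─q (p⊆W x∈p) λ x∈ → x∈p─q⇒x∉q W p x∈ x∈p

W─[W─p]⊆p : ∀ (W p : Subset n) → W ─ (W ─ p) ⊆ p
W─[W─p]⊆p W p {x} x∈ with x ∈? p
... | yes x∈p = x∈p
... | no x∉p = contradiction (x∈p∧x∉q⇒x∈p─q (p─q⊆p W (W ─ p) x∈) x∉p)
                             (x∈p─q⇒x∉q W (W ─ p) x∈)

∣p∪⁅x⁆∣≡1+∣p∣ : ∀ (p : Subset n) x → x ∉ p → ∣ p ∪ ⁅ x ⁆ ∣ ≡ suc ∣ p ∣
∣p∪⁅x⁆∣≡1+∣p∣ (inside ∷ p) zero x∉p = contradiction here x∉p
∣p∪⁅x⁆∣≡1+∣p∣ (outside ∷ p) zero x∉p = cong (suc ∘ ∣_∣) (∪-identityʳ p)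
∣p∪⁅x⁆∣≡1+∣p∣ (inside ∷ p) (suc x) x∉p = cong suc (∣p∪⁅x⁆∣≡1+∣p∣ p x (x∉p ∘ there))
∣p∪⁅x⁆∣≡1+∣p∣ (outside ∷ p) (suc x) x∉p = ∣p∪⁅x⁆∣≡1+∣p∣ p x (x∉p ∘ there)

1+∣p-x∣≡∣p∣ : x ∈ p → suc ∣ p - x ∣ ≡ ∣ p ∣
1+∣p-x∣≡∣p∣ {x = x} {p = p} x∈p =
  trans (sym (∣p∪⁅x⁆∣≡1+∣p∣ (p - x) x (v∉W-v p x)))
        (cong ∣_∣ (⊆-antisym (∪-⁅⁆-⊆ (p-x⊆p p x) x∈p) (p⊆p-x∪⁅x⁆ p x)))

⊆∧∣∣≡⇒≡ : p ⊆ q → ∣ p ∣ ≡ ∣ q ∣ → p ≡ q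
⊆∧∣∣≡⇒≡ {p = p} {q = q} p⊆q eq = ⊆-antisym p⊆q λ {x} x∈q →
  decidable-stable (x ∈? p) λ x∉p →
    ℕ.<⇒≢ (p⊂q⇒∣p∣<∣q∣ (p⊆q , x , x∈q , x∉p)) eq

∣p∣≡1⇒p≡⁅x⁆ : ∀ (p : Subset n) → ∣ p ∣ ≡ 1 → ∃[ x ] p ≡ ⁅ x ⁆
∣p∣≡1⇒p≡⁅x⁆ {n} p eq with nonempty? p
... | yes (x , x∈p) = x , sym (⊆∧∣∣≡⇒≡ (⁅x⁆⊆p x∈p) (trans (∣⁅x⁆∣≡1 x) (sym eq)))
... | no empty with refl ← Empty-unique empty = contradiction (trans (sym eq) (∣⊥∣≡0 n)) λ ()

-- Two singletons with a common element coincide.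
x∈p∧x∈q∧p≢q⇒2≤∣p∣ : x ∈ p → x ∈ q → p ≢ q → ∣ p ∣ ≡ ∣ q ∣ → 2 ≤ ∣ p ∣
x∈p∧x∈q∧p≢q⇒2≤∣p∣ {x = x} {p} x∈p x∈q p≢q ∣p∣≡∣q∣ = ℕ.≤∧≢⇒<
  (subst (_≤ ∣ p ∣) (∣⁅x⁆∣≡1 x) (p⊆q⇒∣p∣≤∣q∣ (⁅x⁆⊆p x∈p)))
  λ 1≡∣p∣ → p≢q (trans
    (sym (⊆∧∣∣≡⇒≡ (⁅x⁆⊆p x∈p) (trans (∣⁅x⁆∣≡1 x) 1≡∣p∣)))
    (⊆∧∣∣≡⇒≡ (⁅x⁆⊆p x∈q) (trans (∣⁅x⁆∣≡1 x) (trans 1≡∣p∣ ∣p∣≡∣q∣))))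

-- Alexander duality relative to a ground set

module _ {n : ℕ} where

  -- A relation rather than an operation: the recursion reaches `del v Γ` and `link v Γ`, whose
  -- faces match those of a dual on a smaller ground set only up to logical equivalence.
  Dual : Subset n → Complex n → Complex n → Set
  Dual W Δ Γ = ∀ F → Face Γ F ⇔ (F ⊆ W × ¬ Face Δ (W ─ F))

  dual-⊤ : ∀ Δ → Dual ⊤ Δ (Δ ^∨)
  dual-⊤ Δ F = mk⇔
    (λ ∁F∉Δ → ⊆⊤ , ∁F∉Δ ∘ closed Δ λ x∈ → x∈p∧x∉q⇒x∈p─q ∈⊤ (x∈∁p⇒x∉p x∈))
    (λ (_ , N) → N ∘ closed Δ λ x∈ → x∉p⇒x∈∁p (x∈p─q⇒x∉q ⊤ F x∈))

  -- Removing `F ∪ ⁅ v ⁆` from `W` amounts to removing `F` from `W - v`. Only subsets of `W - v` are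
  -- then tested, so `Δ` stands in for its own deletion.
  dual-link : ∀ Δ Γ {W v} → v ∈ W → Dual W Δ Γ → Dual (W - v) Δ (link v Γ)
  dual-link Δ Γ {W} {v} v∈W D F = mk⇔
    (λ (v∉F , F∪v∈Γ) →
      let F∪v⊆W , N∉Δ = to (D (F ∪ ⁅ v ⁆)) F∪v∈Γ in
      ⊆-avoiding (F∪v⊆W ∘ p⊆p∪⁅x⁆ F v) v∉F
      , subst (¬_ ∘ Face Δ) (sym (p-x─q≡p─q∪⁅x⁆ W F v)) N∉Δ)
    (λ (F⊆W-v , N∉Δ) →
      v∉W-v W v ∘ F⊆W-v
      , from (D (F ∪ ⁅ v ⁆))
          ( ∪-⁅⁆-⊆ (p-x⊆p W v ∘ F⊆W-v) v∈W
          , subst (¬_ ∘ Face Δ) (p-x─q≡p─q∪⁅x⁆ W F v) N∉Δ))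

  -- For `v ∉ F` the complement of `F` in `W` is its complement in `W - v` with `v` added, so the
  -- former is a face of `Δ` exactly when the latter is in the link.
  dual-del : ∀ Δ Γ {W v} → v ∈ W → Dual W Δ Γ → Dual (W - v) (link v Δ) (del v Γ)
  dual-del Δ Γ {W} {v} v∈W D F = mk⇔
    (λ (v∉F , F∈Γ) →
      let F⊆W , N∉Δ = to (D F) F∈Γ in
      ⊆-avoiding F⊆W v∉F
      , λ (_ , N∈link) → N∉Δ (closed Δ W─F⊆ N∈link))
    (λ (F⊆W-v , N∉link) →
      let v∉F = v∉W-v W v ∘ F⊆W-v in
      v∉F
      , from (D F)
          ( p-x⊆p W v ∘ F⊆W-v
          , λ N∈Δ → N∉link
              ( v∉W-v W v ∘ p─q⊆p (W - v) F
              , closed Δ (∪-⁅⁆-⊆ W-v─F⊆W─F (x∈p∧x∉q⇒x∈p─q v∈W v∉F)) N∈Δ)))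
    where
    W-v─F⊆W─F : W - v ─ F ⊆ W ─ F
    W-v─F⊆W─F x∈ =
      x∈p∧x∉q⇒x∈p─q (p-x⊆p W v (p─q⊆p (W - v) F x∈)) (x∈p─q⇒x∉q (W - v) F x∈)
    W─F⊆ : W ─ F ⊆ (W - v ─ F) ∪ ⁅ v ⁆
    W─F⊆ {x} x∈ with x Fin.≟ v
    ... | yes refl = x∈p∪⁅x⁆ (W - v ─ F) v
    ... | no x≢v = p⊆p∪⁅x⁆ (W - v ─ F) v
      (x∈p∧x∉q⇒x∈p─q (x∈p∧x≢y⇒x∈p-y (p─q⊆p W F x∈) x≢v) (x∈p─q⇒x∉q W F x∈))

  -- If v is not a vertex of Γ then del v Γ has the same faces as Γ.
  dual-nonvertex : ∀ Δ Γ {W v} → v ∈ W → Face Δ (W - v) →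
                   Dual W Δ Γ → Dual (W - v) (link v Δ) Γ
  dual-nonvertex Δ Γ {W} {v} v∈W W-v∈Δ D F = mk⇔
    (λ F∈Γ → to (dual-del Δ Γ v∈W D F)
      -- `v ∈ F` would place `W ─ F` inside the face `W - v`.
      ( (λ v∈F → proj₂ (to (D F) F∈Γ) (closed Δ (─-antimonoʳ W (⁅x⁆⊆p v∈F)) W-v∈Δ))
      , F∈Γ))
    (proj₂ ∘ from (dual-del Δ Γ v∈W D F))

  dual-face : ∀ Δ Γ {F W} → Dual W Δ Γ → F ⊆ W → Face Δ F → ¬ Face Γ (W ─ F)
  dual-face Δ Γ {F} {W} D F⊆W F∈Δ W─F∈Γ =
    proj₂ (to (D (W ─ F)) W─F∈Γ) (closed Δ (W─[W─p]⊆p W F) F∈Δ)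

  -- Decidability of faces removes the double negation that dualizing twice introduces.
  dual-face⁻ : ∀ Δ Γ {F W} → Dual W Δ Γ → F ⊆ W → ¬ Face Γ (W ─ F) → Face Δ F
  dual-face⁻ Δ Γ {F} {W} D F⊆W W─F∉Γ = decidable-stable (face? Δ F) λ F∉Δ →
    W─F∉Γ (from (D (W ─ F)) (p─q⊆p W F , F∉Δ ∘ closed Δ (p⊆W─[W─p] W F⊆W)))

  -- The premise says that the boundary of the simplex on `N` lies in the link of `v`; for empty `N`
  -- it is vacuous.
  Exchange : Subset n → Fin n → Complex n → Set
  Exchange W v Δ = ∀ N → N ⊆ W - v →
    (∀ z → z ∈ N → Face Δ ((N - z) ∪ ⁅ v ⁆)) → Face Δ N

  -- If `F` were a facet of both link and deletion, let `N` be the complement of `F ∪ ⁅ v ⁆`, a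
  -- non-face of `Δ`. By maximality no `z` in `N` can be added to `F`, which dually is the premise
  -- of the exchange property, so `N` would be a face.
  exchange⇒shedding : ∀ Δ Γ {W v} → Dual W Δ Γ → v ∈ W → ¬ Face Δ (W - v) →
                      Exchange W v Δ → IsShedding Γ v
  exchange⇒shedding Δ Γ {W} {v} D v∈W W-v∉Δ exch =
    from (D ⁅ v ⁆) (⁅x⁆⊆p v∈W , W-v∉Δ) , not-both
    where
    not-both : ∀ F → IsFacet (link v Γ) F → ¬ IsFacet (del v Γ) F
    not-both F ((v∉F , F∪v∈Γ) , _) (_ , F-max) =
      proj₂ (to (D (F ∪ ⁅ v ⁆)) F∪v∈Γ) (exch N N⊆W-v step)
      where
      N = W ─ (F ∪ ⁅ v ⁆)
      F∪v⊆W = proj₁ (to (D (F ∪ ⁅ v ⁆)) F∪v∈Γ)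
      N∩[F∪v]≡∅ : ∀ {x} → x ∈ N → x ∉ F ∪ ⁅ v ⁆
      N∩[F∪v]≡∅ = x∈p─q⇒x∉q W (F ∪ ⁅ v ⁆)
      v∉N : v ∉ N
      v∉N v∈N = N∩[F∪v]≡∅ v∈N (x∈p∪⁅x⁆ F v)
      N⊆W-v : N ⊆ W - v
      N⊆W-v = ⊆-avoiding (p─q⊆p W (F ∪ ⁅ v ⁆)) v∉N
      step : ∀ z → z ∈ N → Face Δ ((N - z) ∪ ⁅ v ⁆)
      -- `G` is `F` with `z` added, so as a face it would contradict the maximality of `F` in the
      -- deletion.
      step z z∈N = dual-face⁻ Δ Γ D (∪-⁅⁆-⊆ (p-x⊆p W v ∘ N⊆W-v ∘ p-x⊆p N z) v∈W) λ G∈Γ →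
        N∩[F∪v]≡∅ z∈N (p⊆p∪⁅x⁆ F v
          (subst (z ∈_) (F-max G (v∉G , G∈Γ) F⊆G) z∈G))
        where
        M = (N - z) ∪ ⁅ v ⁆
        G = W ─ M
        v∉G : v ∉ G
        v∉G v∈G = x∈p─q⇒x∉q W M v∈G (x∈p∪⁅x⁆ (N - z) v)
        F⊆G : F ⊆ G
        F⊆G x∈F = x∈p∧x∉q⇒x∈p─q (F∪v⊆W (p⊆p∪⁅x⁆ F v x∈F)) λ x∈M →
          case x∈p∪⁅y⁆⁻ (N - z) x∈M of λ where
            (inj₁ x∈N-z) → N∩[F∪v]≡∅ (p-x⊆p N z x∈N-z) (p⊆p∪⁅x⁆ F v x∈F)
            (inj₂ refl) → v∉F x∈F
        z∈G : z ∈ G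
        z∈G = x∈p∧x∉q⇒x∈p─q (p─q⊆p W (F ∪ ⁅ v ⁆) z∈N) λ z∈M →
          case x∈p∪⁅y⁆⁻ (N - z) z∈M of λ where
            (inj₁ z∈N-z) → v∉W-v N z z∈N-z
            (inj₂ refl) → v∉N z∈N

  -- If `N` were not a face, then `F`, the complement of `N ∪ ⁅ v ⁆`, would be a facet of both link
  -- and deletion: a larger face avoiding `v` would contain some `x` of `N`, and its complement
  -- would lie in the face `(N - x) ∪ ⁅ v ⁆`. Faces of the link are faces of the deletion, so
  -- `maximal` serves both.
  shedding⇒exchange : ∀ Δ Γ {W v} → Dual W Δ Γ → v ∈ W →
                      IsShedding Γ v → Exchange W v Δ
  shedding⇒exchange Δ Γ {W} {v} D v∈W (_ , not-both) N N⊆W-v h =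
    decidable-stable (face? Δ N) λ N∉Δ →
      let
        F∪v∈Γ = from (D (F ∪ ⁅ v ⁆)) (F∪v⊆W , N∉Δ ∘ closed Δ N⊆W─[F∪v])
      in not-both F
        ( (v∉F , F∪v∈Γ)
        , λ G (v∉G , G∪v∈Γ) → maximal G v∉G (closed Γ (p⊆p∪⁅x⁆ G v) G∪v∈Γ))
        ( (v∉F , closed Γ (p⊆p∪⁅x⁆ F v) F∪v∈Γ)
        , λ G (v∉G , G∈Γ) → maximal G v∉G G∈Γ)
    where
    F = W ─ (N ∪ ⁅ v ⁆)
    v∉F : v ∉ F
    v∉F v∈F = x∈p─q⇒x∉q W (N ∪ ⁅ v ⁆) v∈F (x∈p∪⁅x⁆ N v)
    F∪v⊆W : F ∪ ⁅ v ⁆ ⊆ W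
    F∪v⊆W = ∪-⁅⁆-⊆ (p─q⊆p W (N ∪ ⁅ v ⁆)) v∈W
    N⊆W─[F∪v] : N ⊆ W ─ (F ∪ ⁅ v ⁆)
    N⊆W─[F∪v] x∈N = x∈p∧x∉q⇒x∈p─q (p-x⊆p W v (N⊆W-v x∈N)) λ x∈ →
      case x∈p∪⁅y⁆⁻ F x∈ of λ where
        (inj₁ x∈F) → x∈p─q⇒x∉q W (N ∪ ⁅ v ⁆) x∈F (p⊆p∪⁅x⁆ N v x∈N)
        (inj₂ refl) → v∉W-v W v (N⊆W-v x∈N)
    maximal : ∀ G → v ∉ G → Face Γ G → F ⊆ G → G ≡ F
    maximal G v∉G G∈Γ F⊆G = ⊆-antisym G⊆F F⊆G
      where
      G⊆W = proj₁ (to (D G) G∈Γ)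
      avoids-N : ∀ {x} → x ∈ G → x ∉ N
      avoids-N {x} x∈G x∈N = proj₂ (to (D G) G∈Γ) (closed Δ W─G⊆ (h x x∈N))
        where
        W─G⊆ : W ─ G ⊆ (N - x) ∪ ⁅ v ⁆
        W─G⊆ {y} y∈ with y ∈? N ∪ ⁅ v ⁆
        ... | no y∉ = contradiction (F⊆G (x∈p∧x∉q⇒x∈p─q (p─q⊆p W G y∈) y∉))
                                    (x∈p─q⇒x∉q W G y∈)
        ... | yes y∈N∪v with x∈p∪⁅y⁆⁻ N y∈N∪v
        ...   | inj₂ refl = x∈p∪⁅x⁆ (N - x) v
        ...   | inj₁ y∈N = p⊆p∪⁅x⁆ (N - x) v
                (x∈p∧x≢y⇒x∈p-y y∈N λ { refl → x∈p─q⇒x∉q W G y∈ x∈G })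
      G⊆F : G ⊆ F
      G⊆F x∈G = x∈p∧x∉q⇒x∈p─q (G⊆W x∈G) λ x∈ →
        case x∈p∪⁅y⁆⁻ N x∈ of λ where
          (inj₁ x∈N) → avoids-N x∈G x∈N
          (inj₂ refl) → v∉G x∈G

  -- Skeleton-E-chordal complexes

  -- The shared maximum is a common vertex `m`, not a common label. So `lab` can be any function on
  -- the ground set and stays fixed while `W` and `Δ` change.
  EChordalOn : Subset n → Complex n → (Fin n → ℕ) → Set
  EChordalOn W Δ lab = ∀ m f g → f ⊆ W → g ⊆ W → Face Δ f → Face Δ g →
    m ∈ f → m ∈ g → f ≢ g → ∣ f ∣ ≡ ∣ g ∣ → (∀ x → x ∈ f ∪ g → lab x ≤ lab m) →
    ∀ h → h ⊆ f ∪ g → ∣ h ∣ ≡ ∣ f ∣ → Face Δ h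

  -- Non-vertices go first. That all of `W` are vertices in the second case settles the exchange
  -- property for one-element `N`.
  Extremal : Subset n → Complex n → (Fin n → ℕ) → Fin n → Set
  Extremal W Δ lab v =
    ¬ IsVertex Δ v ⊎ (∀ x → x ∈ W → IsVertex Δ x × lab x ≤ lab v)

  extremal-exists : ∀ W Δ lab → Nonempty W → ∃[ v ] v ∈ W × Extremal W Δ lab v
  extremal-exists W Δ lab (w , w∈W)
    with Fin.any? (λ v → v ∈? W ×-dec ¬? (face? Δ ⁅ v ⁆))
  ... | yes (v , v∈W , v∉Δ) = v , v∈W , inj₁ v∉Δ
  ... | no vertices = argmax lab w ws , argmax-all lab w∈W (all-filter (_∈? W) (allFin n))
                    , inj₂ λ x x∈W →
                        decidable-stable (face? Δ ⁅ x ⁆) (λ x∉Δ → vertices (x , x∈W , x∉Δ))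
                      , All.lookup (f[xs]≤f[argmax] w ws) (∈-filter⁺ (_∈? W) (∈-allFin x) x∈W)
    where ws = filter (_∈? W) (allFin n)

  -- A face through `v` makes `v` a vertex and so excludes the first alternative.
  extremal-max : ∀ Δ lab {W v f} → Extremal W Δ lab v → Face Δ f → v ∈ f →
                 ∀ x → x ∈ W → IsVertex Δ x × lab x ≤ lab v
  extremal-max Δ lab (inj₁ v∉Δ) f∈Δ v∈f = contradiction (closed Δ (⁅x⁆⊆p v∈f) f∈Δ) v∉Δ
  extremal-max Δ lab (inj₂ max) _ _ = max

  EChordalOn-shrink : ∀ Δ lab {W} v → EChordalOn W Δ lab → EChordalOn (W - v) Δ lab
  EChordalOn-shrink Δ lab {W} v E m f g f⊆ g⊆ =
    E m f g (p-x⊆p W v ∘ f⊆) (p-x⊆p W v ∘ g⊆)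

  -- Adding `v` to `f` and `g` gives faces of `Δ` with common maximum `v`, and E-chordality of `Δ`
  -- then applies to `h ∪ ⁅ v ⁆`.
  EChordalOn-link : ∀ Δ lab {W v} → v ∈ W → Extremal W Δ lab v → EChordalOn W Δ lab →
                    EChordalOn (W - v) (link v Δ) lab
  EChordalOn-link Δ lab {W} {v} v∈W ext E
    m f g f⊆ g⊆ (v∉f , f∪v∈Δ) (v∉g , g∪v∈Δ) _ _ f≢g ∣f∣≡∣g∣ _ h h⊆f∪g ∣h∣≡∣f∣ =
    v∉h , E v (f ∪ ⁅ v ⁆) (g ∪ ⁅ v ⁆) f∪v⊆W g∪v⊆W f∪v∈Δ g∪v∈Δ
            (x∈p∪⁅x⁆ f v) (x∈p∪⁅x⁆ g v) f∪v≢g∪v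
            (trans (∣p∪⁅x⁆∣≡1+∣p∣ f v v∉f)
              (trans (cong suc ∣f∣≡∣g∣) (sym (∣p∪⁅x⁆∣≡1+∣p∣ g v v∉g))))
            (λ x x∈ → proj₂ (extremal-max Δ lab ext f∪v∈Δ (x∈p∪⁅x⁆ f v) x
              ([ f∪v⊆W , g∪v⊆W ]′ (x∈p∪q⁻ (f ∪ ⁅ v ⁆) (g ∪ ⁅ v ⁆) x∈))))
            (h ∪ ⁅ v ⁆)
            (∪-⁅⁆-⊆ (λ x∈h → x∈p∪q⁺ (case x∈p∪q⁻ f g (h⊆f∪g x∈h) of λ where
                       (inj₁ x∈f) → inj₁ (p⊆p∪⁅x⁆ f v x∈f)
                       (inj₂ x∈g) → inj₂ (p⊆p∪⁅x⁆ g v x∈g)))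
                    (x∈p∪q⁺ (inj₁ (x∈p∪⁅x⁆ f v))))
            (trans (∣p∪⁅x⁆∣≡1+∣p∣ h v v∉h)
              (trans (cong suc ∣h∣≡∣f∣) (sym (∣p∪⁅x⁆∣≡1+∣p∣ f v v∉f))))
    where
    v∉h : v ∉ h
    v∉h = [ v∉f , v∉g ]′ ∘ x∈p∪q⁻ f g ∘ h⊆f∪g
    f∪v⊆W : f ∪ ⁅ v ⁆ ⊆ W
    f∪v⊆W = ∪-⁅⁆-⊆ (p-x⊆p W v ∘ f⊆) v∈W
    g∪v⊆W : g ∪ ⁅ v ⁆ ⊆ W
    g∪v⊆W = ∪-⁅⁆-⊆ (p-x⊆p W v ∘ g⊆) v∈W
    cancel : ∀ {p q} → v ∉ p → p ∪ ⁅ v ⁆ ≡ q ∪ ⁅ v ⁆ → p ⊆ q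
    cancel {p} {q} v∉p eq {x} x∈p
      with x∈p∪⁅y⁆⁻ q (subst (x ∈_) eq (p⊆p∪⁅x⁆ p v x∈p))
    ... | inj₁ x∈q = x∈q
    ... | inj₂ refl = contradiction x∈p v∉p
    f∪v≢g∪v : f ∪ ⁅ v ⁆ ≢ g ∪ ⁅ v ⁆
    f∪v≢g∪v eq = f≢g (⊆-antisym (cancel v∉f eq) (cancel v∉g (sym eq)))

  -- For distinct `x` and `y` in `N`, the faces `(N - x) ∪ ⁅ v ⁆` and `(N - y) ∪ ⁅ v ⁆` have the
  -- size of `N`, maximum `v`, and a union containing `N`. Smaller `N` are treated separately.
  EChordalOn⇒exchange : ∀ Δ lab {W v} → v ∈ W → Extremal W Δ lab v → EChordalOn W Δ lab →
                        Face Δ ⊥ → Exchange W v Δ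
  EChordalOn⇒exchange Δ lab {W} {v} v∈W ext E ∅∈Δ N N⊆W-v h with nonempty? N
  ... | no empty = subst (Face Δ) (sym (Empty-unique empty)) ∅∈Δ
  ... | yes (x , x∈N) with nonempty? (N - x)
  ...   | no empty = closed Δ N⊆⁅x⁆
            (proj₁ (extremal-max Δ lab ext (h x x∈N) (x∈p∪⁅x⁆ (N - x) v) x
              (p-x⊆p W v (N⊆W-v x∈N))))
    where
    N⊆⁅x⁆ : N ⊆ ⁅ x ⁆
    N⊆⁅x⁆ {z} z∈N with z Fin.≟ x
    ... | yes refl = x∈⁅x⁆ x
    ... | no z≢x = contradiction (z , x∈p∧x≢y⇒x∈p-y z∈N z≢x) empty
  ...   | yes (y , y∈N-x) =
    E v (f x) (f y) (f⊆W x) (f⊆W y) (h x x∈N) (h y y∈N)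
      (x∈p∪⁅x⁆ (N - x) v) (x∈p∪⁅x⁆ (N - y) v) f≢g (trans (∣f∣ x∈N) (sym (∣f∣ y∈N)))
      (λ z z∈ → proj₂ (extremal-max Δ lab ext (h x x∈N) (x∈p∪⁅x⁆ (N - x) v) z
        ([ f⊆W x , f⊆W y ]′ (x∈p∪q⁻ (f x) (f y) z∈))))
      N N⊆f∪g (sym (∣f∣ x∈N))
    where
    f : Fin n → Subset n
    f z = (N - z) ∪ ⁅ v ⁆
    y∈N = p-x⊆p N x y∈N-x
    v∉N : v ∉ N
    v∉N = v∉W-v W v ∘ N⊆W-v
    f⊆W : ∀ z → f z ⊆ W
    f⊆W z = ∪-⁅⁆-⊆ (p-x⊆p W v ∘ N⊆W-v ∘ p-x⊆p N z) v∈W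
    ∣f∣ : ∀ {z} → z ∈ N → ∣ f z ∣ ≡ ∣ N ∣
    ∣f∣ {z} z∈N = trans (∣p∪⁅x⁆∣≡1+∣p∣ (N - z) v (v∉N ∘ p-x⊆p N z)) (1+∣p-x∣≡∣p∣ z∈N)
    f≢g : f x ≢ f y
    f≢g eq with x∈p∪⁅y⁆⁻ (N - y) (subst (y ∈_) eq (p⊆p∪⁅x⁆ (N - x) v y∈N-x))
    ... | inj₁ y∈N-y = v∉W-v N y y∈N-y
    ... | inj₂ refl = v∉N y∈N
    N⊆f∪g : N ⊆ f x ∪ f y
    N⊆f∪g {z} z∈N with z Fin.≟ x
    ... | no z≢x = x∈p∪q⁺ (inj₁ (p⊆p∪⁅x⁆ (N - x) v (x∈p∧x≢y⇒x∈p-y z∈N z≢x)))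
    ... | yes refl = x∈p∪q⁺ (inj₂ (p⊆p∪⁅x⁆ (N - y) v
            (x∈p∧x≢y⇒x∈p-y z∈N (x∈p-y⇒x≢y N y∈N-x ∘ sym))))

  EChordalOn⇒dual-VD : ∀ Δ Γ lab {W} → Acc _⊂_ W → Dual W Δ Γ → EChordalOn W Δ lab →
                       VertexDecomposable Γ
  EChordalOn⇒dual-VD Δ Γ lab {W} (acc rec) D E with face? Δ ⊥
  -- Without faces in `Δ`, every subset of `W` is a face of the dual.
  ... | no ∅∉Δ = simplex (W , λ F → mk⇔ {B = F ⊆ W}
          (λ F∈Γ → proj₁ (to (D F) F∈Γ))
          (λ F⊆W → from (D F) (F⊆W , ∅∉Δ ∘ closed Δ ⊥⊆)))
  ... | yes ∅∈Δ with nonempty? W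
  ...   | no empty = no-faces λ F F∈Γ → proj₂ (to (D F) F∈Γ)
            (closed Δ (λ {x} x∈ → contradiction (x , p─q⊆p W F x∈) empty) ∅∈Δ)
  ...   | yes W≢∅ with extremal-exists W Δ lab W≢∅
  ...     | v , v∈W , ext with face? Δ (W - v)
  -- Here `v` is not a vertex of `Γ`: the ground set shrinks while `Γ` stays.
  ...       | yes W-v∈Δ = EChordalOn⇒dual-VD (link v Δ) Γ lab (rec (x∈p⇒p-x⊂p v∈W))
                (dual-nonvertex Δ Γ v∈W W-v∈Δ D) (EChordalOn-link Δ lab v∈W ext E)
  ...       | no W-v∉Δ = shed v
                (exchange⇒shedding Δ Γ D v∈W W-v∉Δ
                  (EChordalOn⇒exchange Δ lab v∈W ext E ∅∈Δ))
                (EChordalOn⇒dual-VD (link v Δ) (del v Γ) lab (rec (x∈p⇒p-x⊂p v∈W))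
                  (dual-del Δ Γ v∈W D) (EChordalOn-link Δ lab v∈W ext E))
                (EChordalOn⇒dual-VD Δ (link v Γ) lab (rec (x∈p⇒p-x⊂p v∈W))
                  (dual-link Δ Γ v∈W D)
                  (EChordalOn-shrink Δ lab v E))

  -- Skeleton-clique-chordal complexes

  -- Ranks run against the labels: the vertex shed first has rank 0.  They need
  -- not be injective, so ties may later be broken arbitrarily.
  CliqueChordalOn : Subset n → Complex n → (Fin n → ℕ) → Set
  CliqueChordalOn W Δ rank = ∀ m f g → f ⊆ W → g ⊆ W → Face Δ f → Face Δ g →
    m ∈ f → m ∈ g → (∀ x → x ∈ f ∪ g → rank m ≤ rank x) →
    ∀ e → e ⊆ f ∪ g → ∣ e ∣ ≡ 2 → Face Δ e

  rank-first : Fin n → (Fin n → ℕ) → Fin n → ℕ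
  rank-first v rank x with x Fin.≟ v
  ... | yes _ = 0
  ... | no _ = suc (rank x)

  rank-first-≡ : ∀ v rank → rank-first v rank v ≡ 0
  rank-first-≡ v rank with v Fin.≟ v
  ... | yes _ = refl
  ... | no v≢v = contradiction refl v≢v

  rank-first-≢ : ∀ {v x} rank → x ≢ v → rank-first v rank x ≡ suc (rank x)
  rank-first-≢ {v} {x} rank x≢v with x Fin.≟ v
  ... | yes x≡v = contradiction x≡v x≢v
  ... | no _ = refl

  -- Since `v` is in both faces, the one containing the point of `p` contains the edge. The
  -- singleton is given by its size to fit `e - z` for a pair `e`.
  edge-at : ∀ (Δ : Complex n) f g {v p} → Face Δ f → Face Δ g → v ∈ f → v ∈ g → p ⊆ f ∪ g →
            ∣ p ∣ ≡ 1 → Face Δ (p ∪ ⁅ v ⁆)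
  edge-at Δ f g {p = p} f∈Δ g∈Δ v∈f v∈g p⊆f∪g ∣p∣≡1
    with w , refl ← ∣p∣≡1⇒p≡⁅x⁆ p ∣p∣≡1 with x∈p∪q⁻ f g (p⊆f∪g (x∈⁅x⁆ w))
  ... | inj₁ w∈f = closed Δ (∪-⁅⁆-⊆ (⁅x⁆⊆p w∈f) v∈f) f∈Δ
  ... | inj₂ w∈g = closed Δ (∪-⁅⁆-⊆ (⁅x⁆⊆p w∈g) v∈g) g∈Δ

  -- If the common minimum is `v`, pairs through `v` lie in `f` or `g`, and the other pairs follow
  -- by exchange. Otherwise its rank is positive, so `v`, of rank 0, is in neither face and both lie
  -- in `W - v`.
  CliqueChordalOn-extend : ∀ Δ rank {W} v →
    (∀ e → e ⊆ W - v → ∣ e ∣ ≡ 2 → (∀ z → z ∈ e → Face Δ ((e - z) ∪ ⁅ v ⁆)) → Face Δ e) →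
    CliqueChordalOn (W - v) Δ rank → CliqueChordalOn W Δ (rank-first v rank)
  CliqueChordalOn-extend Δ rank {W} v exch C
    m f g f⊆W g⊆W f∈Δ g∈Δ m∈f m∈g m-min e e⊆f∪g ∣e∣≡2 with m Fin.≟ v
  ... | yes refl with v ∈? e
  ...   | yes v∈e = closed Δ (p⊆p-x∪⁅x⁆ e v) (edge-at Δ f g f∈Δ g∈Δ m∈f m∈g
            (e⊆f∪g ∘ p-x⊆p e v) (ℕ.suc-injective (trans (1+∣p-x∣≡∣p∣ v∈e) ∣e∣≡2)))
  ...   | no v∉e = exch e (⊆-avoiding ([ f⊆W , g⊆W ]′ ∘ x∈p∪q⁻ f g ∘ e⊆f∪g) v∉e) ∣e∣≡2
            λ z z∈e → edge-at Δ f g f∈Δ g∈Δ m∈f m∈g (e⊆f∪g ∘ p-x⊆p e z)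
              (ℕ.suc-injective (trans (1+∣p-x∣≡∣p∣ z∈e) ∣e∣≡2))
  CliqueChordalOn-extend Δ rank {W} v exch C
    m f g f⊆W g⊆W f∈Δ g∈Δ m∈f m∈g m-min e e⊆f∪g ∣e∣≡2 | no m≢v =
    C m f g (⊆-avoiding f⊆W (v∉ ∘ x∈p∪q⁺ ∘ inj₁)) (⊆-avoiding g⊆W (v∉ ∘ x∈p∪q⁺ ∘ inj₂))
      f∈Δ g∈Δ m∈f m∈g
      (λ x x∈ → s≤s⁻¹ (subst (suc (rank m) ≤_)
        (rank-first-≢ rank (λ { refl → v∉ x∈ })) (m-min x x∈)))
      e e⊆f∪g ∣e∣≡2
    where
    v∉ : v ∉ f ∪ g
    v∉ v∈ with () ← subst (suc (rank m) ≤_) (rank-first-≡ v rank) (m-min v v∈)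

  -- If `W` lies in `U`, then `Δ` has no face inside `W`. Otherwise any `v` in `W ─ U` can come
  -- first: a set avoiding `v` has a complement containing `v`, hence outside `Γ`, so every subset
  -- of `W - v` is a face of `Δ`.
  dual-simplex⇒CliqueChordalOn : ∀ Δ Γ {W} → IsSimplex Γ → Dual W Δ Γ →
                                 ∃[ rank ] CliqueChordalOn W Δ rank
  dual-simplex⇒CliqueChordalOn Δ Γ {W} (U , Γ≃U) D with nonempty? (W ─ U)
  ... | no W⊆U = const 0 , λ m f g f⊆W g⊆W f∈Δ → contradiction
          (from (Γ≃U (W ─ f)) λ {x} x∈ → decidable-stable (x ∈? U) λ x∉U →
            W⊆U (x , x∈p∧x∉q⇒x∈p─q (p─q⊆p W f x∈) x∉U))
          (dual-face Δ Γ D f⊆W f∈Δ)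
  ... | yes (v , v∈W─U) = rank-first v (const 0) ,
          CliqueChordalOn-extend Δ (const 0) v (λ e e⊆ _ _ → ⊆W-v⇒face e e⊆)
            λ m f g f⊆ g⊆ _ _ _ _ _ e e⊆f∪g _ →
              ⊆W-v⇒face e ([ f⊆ , g⊆ ]′ ∘ x∈p∪q⁻ f g ∘ e⊆f∪g)
    where
    ⊆W-v⇒face : ∀ e → e ⊆ W - v → Face Δ e
    ⊆W-v⇒face e e⊆ = dual-face⁻ Δ Γ D (p-x⊆p W v ∘ e⊆) λ W─e∈Γ →
      x∈p─q⇒x∉q W U v∈W─U (to (Γ≃U (W ─ e)) W─e∈Γ
        (x∈p∧x∉q⇒x∈p─q (p─q⊆p W U v∈W─U) (v∉W-v W v ∘ e⊆)))

  -- The induction follows the links: the link of `v` is dual to `Δ` on `W - v` and ranks the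
  -- remaining points, and `v` is put in front of them.
  dual-VD⇒CliqueChordalOn : ∀ {Γ} → VertexDecomposable Γ → ∀ Δ {W} → Dual W Δ Γ →
                            ∃[ rank ] CliqueChordalOn W Δ rank
  dual-VD⇒CliqueChordalOn {Γ} (simplex s) Δ D =
    dual-simplex⇒CliqueChordalOn Δ Γ s D
  dual-VD⇒CliqueChordalOn {Γ} (only-∅ Γ≃∅) Δ D =
    dual-simplex⇒CliqueChordalOn Δ Γ (⊥ , λ F → mk⇔ {B = F ⊆ ⊥}
      (λ F∈Γ → ⊆-reflexive (to (Γ≃∅ F) F∈Γ))
      (λ F⊆⊥ → from (Γ≃∅ F) (⊆-antisym F⊆⊥ ⊥⊆))) D
  dual-VD⇒CliqueChordalOn {Γ} (no-faces ∉Γ) Δ D =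
    const 0 , λ m f g f⊆ g⊆ _ _ _ _ _ e e⊆f∪g _ →
      dual-face⁻ Δ Γ D ([ f⊆ , g⊆ ]′ ∘ x∈p∪q⁻ f g ∘ e⊆f∪g) (∉Γ _)
  dual-VD⇒CliqueChordalOn {Γ} (shed v s@(v∈Γ , _) _ VD-link) Δ D =
    let v∈W = proj₁ (to (D ⁅ v ⁆) v∈Γ) (x∈⁅x⁆ v)
        rank , C = dual-VD⇒CliqueChordalOn VD-link Δ (dual-link Δ Γ v∈W D)
    in rank-first v rank , CliqueChordalOn-extend Δ rank v
         (λ e e⊆ _ → shedding⇒exchange Δ Γ D v∈W s e e⊆) C

-- Labelings

lookup-injective : ∀ {A : Set} {xs : List A} → Unique xs →
                   ∀ i j → List.lookup xs i ≡ List.lookup xs j → i ≡ j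
lookup-injective (_ ∷ _) zero zero _ = refl
lookup-injective {xs = _ ∷ xs} (x≢ ∷ _) zero (suc j) eq =
  contradiction eq (All.lookup x≢ (∈-lookup {xs = xs} j))
lookup-injective {xs = _ ∷ xs} (x≢ ∷ _) (suc i) zero eq =
  contradiction (sym eq) (All.lookup x≢ (∈-lookup {xs = xs} i))
lookup-injective (_ ∷ uniq) (suc i) (suc j) eq = cong suc (lookup-injective uniq i j eq)

module _ {n : ℕ} (Δ : Complex n) (rank : Fin n → ℕ) where

  private
    -- Flipped because positions in the sorted list become labels, and low rank must mean large
    -- label.
    by-decreasing-rank : DecTotalOrder _ _ _
    by-decreasing-rank = Flip.decTotalOrder (On.decTotalOrder ℕ.≤-decTotalOrder rank)

    open Sort by-decreasing-rank using (sort; sort-↭; sort-↗)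

    vertices sorted : List (Fin n)
    vertices = filter (face? Δ ∘ ⁅_⁆) (allFin n)
    sorted = sort vertices

    sorted-unique : Unique sorted
    sorted-unique = Permutationₛ.Unique-resp-↭ (setoid (Fin n))
      (↭⇒↭ₛ (↭-sym (sort-↭ vertices)))
      (Unique.filter⁺ (face? Δ ∘ ⁅_⁆) (Unique.allFin⁺ n))

    ∈-sorted⁺ : ∀ {x} → IsVertex Δ x → x ∈ₗ sorted
    ∈-sorted⁺ {x} x∈Δ = ∈-resp-↭ (↭-sym (sort-↭ vertices))
      (∈-filter⁺ (face? Δ ∘ ⁅_⁆) (∈-allFin x) x∈Δ)

    ∈-sorted⁻ : ∀ {x} → x ∈ₗ sorted → IsVertex Δ x
    ∈-sorted⁻ x∈ = proj₂ (∈-filter⁻ (face? Δ ∘ ⁅_⁆) {xs = allFin n}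
      (∈-resp-↭ (sort-↭ vertices) x∈))

    vertex∈sorted : (u : Vertex Δ) → value u ∈ₗ sorted
    -- The proof of being a vertex is irrelevant; decidability of faces recovers a usable one.
    vertex∈sorted (x , [ x∈Δ ]) = ∈-sorted⁺ (recompute (face? Δ ⁅ x ⁆) x∈Δ)

    label : Vertex Δ → Fin (length sorted)
    label u = index (vertex∈sorted u)

    vertex-at : Fin (length sorted) → Vertex Δ
    vertex-at i = List.lookup sorted i , [ ∈-sorted⁻ (∈-lookup i) ]

    lookup-label : ∀ u → List.lookup sorted (label u) ≡ value u
    lookup-label u = sym (lookup-index (vertex∈sorted u))

  ranked-labeling : VertexLabeling Δ
  ranked-labeling = length sorted , mk↔ₛ′ label
    vertex-at
    (λ i → lookup-injective sorted-unique _ i (lookup-label (vertex-at i)))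
    (λ u → value-injective (lookup-label u))

  ranked-labeling-≤ : ∀ u v →
    let label = Inverse.to (proj₂ ranked-labeling) in
    label u Fin.≤ label v → rank (value v) ≤ rank (value u)
  ranked-labeling-≤ u v u≤v = subst₂ (λ x y → rank y ≤ rank x)
    (lookup-label u) (lookup-label v)
    (lookup-mono-≤ (DecTotalOrder.totalOrder by-decreasing-rank) (sort-↗ vertices) u≤v)

-- Passing between labelings of vertices and functions on the ground set

module _ {n : ℕ} (Δ : Complex n) where

  vertex-of : ∀ {f x} → Face Δ f → x ∈ f → IsVertex Δ x
  vertex-of f∈Δ x∈f = closed Δ (⁅x⁆⊆p x∈f) f∈Δ

  -- Labels are injective, so both maxima are attained at one vertex.
  sameMax-vertex : (L@(_ , ℓ) : VertexLabeling Δ) → ∀ {f g} → SameMax {Δ = Δ} L f g →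
    ∃[ u ] value u ∈ f × value u ∈ g ×
      (∀ w → value w ∈ f ∪ g → Inverse.to ℓ w Fin.≤ Inverse.to ℓ u)
  sameMax-vertex (_ , ℓ) {f} {g} (m , ((u , u∈f , refl) , f≤) , ((u′ , u′∈g , eq) , g≤)) =
    u , u∈f , subst (λ w → value w ∈ g) (Injection.injective (↔⇒↣ ℓ) eq) u′∈g ,
    λ w → [ f≤ w , g≤ w ]′ ∘ x∈p∪q⁻ f g

  SkeletonEChordal⇒EChordalOn : SkeletonEChordal Δ → ∃[ lab ] EChordalOn ⊤ Δ lab
  SkeletonEChordal⇒EChordalOn ((_ , ℓ) , E) =
    lab , λ m f g _ _ f∈Δ g∈Δ m∈f m∈g f≢g ∣f∣≡∣g∣ m-max →
      let u = m , [ vertex-of f∈Δ m∈f ] in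
      E f g f∈Δ g∈Δ f≢g ∣f∣≡∣g∣
        ( Inverse.to ℓ u
        , ((u , m∈f , refl) , λ w w∈f →
            label-≤ f∈Δ f∈Δ w∈f m∈f (m-max (value w) (x∈p∪q⁺ (inj₁ w∈f))))
        , ((u , m∈g , refl) , λ w w∈g →
            label-≤ g∈Δ f∈Δ w∈g m∈f (m-max (value w) (x∈p∪q⁺ (inj₂ w∈g)))))
    where
    lab : Fin n → ℕ
    lab x with face? Δ ⁅ x ⁆
    ... | yes x∈Δ = toℕ (Inverse.to ℓ (x , [ x∈Δ ]))
    -- A default for points that are not vertices; no face contains them.
    ... | no _ = 0
    lab-vertex : ∀ u → IsVertex Δ (value u) → lab (value u) ≡ toℕ (Inverse.to ℓ u)
    lab-vertex u u∈Δ with face? Δ ⁅ value u ⁆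
    ... | yes _ = refl
    ... | no u∉Δ = contradiction u∈Δ u∉Δ
    label-≤ : ∀ {f g u v} → Face Δ f → Face Δ g → value u ∈ f → value v ∈ g →
              lab (value u) ≤ lab (value v) → Inverse.to ℓ u Fin.≤ Inverse.to ℓ v
    label-≤ {u = u} {v} f∈Δ g∈Δ u∈f v∈g =
      subst₂ _≤_ (lab-vertex u (vertex-of f∈Δ u∈f)) (lab-vertex v (vertex-of g∈Δ v∈g))

  CliqueChordalOn⇒SkeletonCliqueChordal : ∀ rank → CliqueChordalOn ⊤ Δ rank →
                                          SkeletonCliqueChordal Δ
  CliqueChordalOn⇒SkeletonCliqueChordal rank C = ranked-labeling Δ rank ,
    λ f g f∈Δ g∈Δ _ _ _ max →
      let u , u∈f , u∈g , u-max = sameMax-vertex (ranked-labeling Δ rank) max in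
      C (value u) f g ⊆⊤ ⊆⊤ f∈Δ g∈Δ u∈f u∈g λ x x∈ →
        let x∈Δ = [ vertex-of f∈Δ , vertex-of g∈Δ ]′ (x∈p∪q⁻ f g x∈)
            w = x , [ x∈Δ ]
        in ranked-labeling-≤ Δ rank w u (u-max w x∈)

-- Subflag complexes

module _ {n : ℕ} (Δ : Complex n) where

  -- The size bound descends from `n` until some face attains it; at bound 0 the given face is
  -- largest.
  largest-face : ∀ {F} → Face Δ F → ∃[ G ] Face Δ G × (∀ H → Face Δ H → ∣ H ∣ ≤ ∣ G ∣)
  largest-face {F} F∈Δ = search n λ H _ → ∣p∣≤n H
    where
    search : ∀ k → (∀ H → Face Δ H → ∣ H ∣ ≤ k) →
             ∃[ G ] Face Δ G × (∀ H → Face Δ H → ∣ H ∣ ≤ ∣ G ∣)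
    search zero bound = F , F∈Δ , λ H H∈Δ → ℕ.≤-trans (bound H H∈Δ) z≤n
    search (suc k) bound with anySubset? (λ G → face? Δ G ×-dec ∣ G ∣ ℕ.≟ suc k)
    ... | yes (G , G∈Δ , ∣G∣≡) = G , G∈Δ , λ H → subst (∣ H ∣ ≤_) (sym ∣G∣≡) ∘ bound H
    ... | no none = search k λ H H∈Δ →
            s≤s⁻¹ (ℕ.≤∧≢⇒< (bound H H∈Δ) λ ∣H∣≡ → none (H , H∈Δ , ∣H∣≡))

  dim-exists : ∀ {F} → Face Δ F → ∃[ d ] HasDim Δ d
  dim-exists F∈Δ =
    let G , G∈Δ , G-max = largest-face F∈Δ
        d , ∣G∣≡d+1 = predecessor ∣ G ∣
    in d , (G , G∈Δ , ∣G∣≡d+1) ,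
       λ H H∈Δ → subst (+ ∣ H ∣ ℤ.≤_) ∣G∣≡d+1 (ℤ.+≤+ (G-max H H∈Δ))
    where
    predecessor : ∀ s → ∃[ d ] + s ≡ d ℤ.+ 1ℤ
    predecessor zero = ℤ.-1ℤ , refl
    predecessor (suc s) = + s , cong +_ (ℕ.+-comm 1 s)

  -- Clique-chordality makes `h` a clique, and its size, being that of the face `f`, is at most the
  -- dimension plus one.
  subflag-clique⇒E : Subflag Δ → SkeletonCliqueChordal Δ → SkeletonEChordal Δ
  subflag-clique⇒E subflag (L , C) = L , λ f g f∈Δ g∈Δ f≢g ∣f∣≡∣g∣ max h h⊆f∪g ∣h∣≡∣f∣ →
    let u , u∈f , u∈g , _ = sameMax-vertex Δ L max
        d , dim@(_ , dim-max) = dim-exists f∈Δ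
    in subflag d dim h
         ( (λ v v∈h → [ vertex-of Δ f∈Δ , vertex-of Δ g∈Δ ]′
              (x∈p∪q⁻ f g (h⊆f∪g v∈h)))
         , λ v w v∈h w∈h v≢w → C f g f∈Δ g∈Δ f≢g ∣f∣≡∣g∣
              (x∈p∧x∈q∧p≢q⇒2≤∣p∣ u∈f u∈g f≢g ∣f∣≡∣g∣) max
              (⁅ v ⁆ ∪ ⁅ w ⁆) (∪-⁅⁆-⊆ (⁅x⁆⊆p (h⊆f∪g v∈h)) (h⊆f∪g w∈h))
              (trans (∣p∪⁅x⁆∣≡1+∣p∣ ⁅ v ⁆ w (x≢y⇒x∉⁅y⁆ (v≢w ∘ sym))) (cong suc (∣⁅x⁆∣≡1 v))))
         (subst (λ s → + s ℤ.≤ d ℤ.+ 1ℤ) (sym ∣h∣≡∣f∣) (dim-max f f∈Δ))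

theorem1 : ∀ (n : ℕ) (Δ : Complex n) →
    (SkeletonEChordal Δ → VertexDecomposable (Δ ^∨)) ×
    (VertexDecomposable (Δ ^∨) → SkeletonCliqueChordal Δ) ×
    (Subflag Δ → SkeletonEChordal Δ ⇔ VertexDecomposable (Δ ^∨))
theorem1 n Δ = E⇒VD , VD⇒C , λ subflag → mk⇔ E⇒VD (subflag-clique⇒E Δ subflag ∘ VD⇒C)
  where
  E⇒VD : SkeletonEChordal Δ → VertexDecomposable (Δ ^∨)
  E⇒VD E = EChordalOn⇒dual-VD Δ (Δ ^∨) _ (⊂-wellFounded ⊤) (dual-⊤ Δ)
    (proj₂ (SkeletonEChordal⇒EChordalOn Δ E))
  VD⇒C : VertexDecomposable (Δ ^∨) → SkeletonCliqueChordal Δ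
  VD⇒C VD = CliqueChordalOn⇒SkeletonCliqueChordal Δ _
    (proj₂ (dual-VD⇒CliqueChordalOn VD Δ (dual-⊤ Δ)))
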